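{- Let $A\in\mathcal{PC}_{n}$ be a column perturbed consistent matrix. Then both the Perron vector of $AA^{T}$ and the right Perron vector of $A$ lie in $\mathcal{E}(A)$.
   Context: An $n$-by-$n$ entrywise positive real matrix $A=[a_{ij}]$ is reciprocal if $a_{ji}=1/a_{ij}$ for all $1\le i,j\le n$ (so diagonal entries are $1$); $\mathcal{PC}_n$ denotes the set of such matrices. A matrix $A\in\mathcal{PC}_n$ is consistent if $a_{ik}=a_{ij}a_{jk}$ for all $i,j,k$. For an entrywise positive vector $w\in\mathbb{R}^n$, $w^{(-T)}$ is the row vector with entries $1/w_j$, so $ww^{(-T)}=[w_i/w_j]$. $A\in\mathcal{PC}_n$ is a column perturbed consistent matrix if it has a consistent $(n-1)$-by-$(n-1)$ principal submatrix, i.e., there is an index $k$ such that $a_{il}=a_{ij}a_{jl}$ for all $i,j,l\in\{1,\dots,n\}\setminus\{k\}$ (equivalently, $A$ is a reciprocal matrix obtained from a consistent matrix by modifying one column and the corresponding row). A positive vector $w\in\mathbb{R}^n$ is efficient for $A\in\mathcal{PC}_n$ if for every positive vector $v\in\mathbb{R}^n$, the entrywise inequality $|A-vv^{(-T)}|\le |A-ww^{(-T)}|$ (entrywise absolute values) implies that $v$ is proportional to $w$. $\mathcal{E}(A)$ denotes the set of all positive vectors efficient for $A$. The (right) Perron vector of an entrywise positive square matrix $M$ is the entrywise positive (right) eigenvector of $M$ associated with its spectral radius $\rho(M)$; it is unique up to a positive scalar factor. -}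

module Defs where

open import Algebra.Apartness.Bundles using (HeytingField; HeytingCommutativeRing)
open import Algebra.Bundles using (CommutativeRing)
import Algebra.Definitions.RawMonoid as RawMonoidDefs
import Algebra.Properties.Ring as RingProperties
import Algebra.Properties.Semiring.Sum as Summation
open import Data.Fin.Base using (Fin)
open import Data.Nat.Base as ℕ using (ℕ)
open import Data.Product.Base using (Σ-syntax; ∃-syntax; _×_; _,_; proj₁; proj₂)
open import Data.Sum.Base using (_⊎_)
open import Data.Vec.Functional using (Vector; transpose)
open import Level using (Level; suc) renaming (_⊔_ to _⊔ˡ_)
open import Relation.Binary.Core using (Rel)
open import Relation.Binary.PropositionalEquality.Core using (_≢_)
open import Relation.Binary.Structures using (IsStrictPartialOrder)
open import Relation.Nullary.Negation.Core using (¬_)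
open import Relation.Unary using (Pred)

-- The real numbers, axiomatised as a Cauchy-complete Archimedean ordered
-- field in the constructive sense: `_<_` is not assumed decidable, `_≤_` is its
-- negation, and binary suprema are given, so that absolute values exist
-- without deciding signs.  Classically the only model, up to isomorphism, is ℝ;
-- Bishop's reals form a model without any classical assumption.
record Reals (c ℓ₁ ℓ₂ : Level) : Set (suc (c ⊔ˡ ℓ₁ ⊔ˡ ℓ₂)) where
  infix  4 _<_ _≤_
  infixl 6 _⊔_
  field
    heytingField : HeytingField c ℓ₁ ℓ₂

  open HeytingField heytingField public
  open HeytingCommutativeRing heytingCommutativeRing public using (commutativeRing)
  open CommutativeRing commutativeRing public
    using (semiring; ring; +-rawMonoid)

  field
    _<_                    : Rel Carrier ℓ₂
    <-isStrictPartialOrder : IsStrictPartialOrder _≈_ _<_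
    <⇒#                    : ∀ {x y} → x < y → x # y
    #⇒<⊎>                  : ∀ {x y} → x # y → x < y ⊎ y < x
    +-monoˡ-<              : ∀ {x y} z → x < y → x + z < y + z
    *-pos                  : ∀ {x y} → 0# < x → 0# < y → 0# < x * y

  _≤_ : Rel Carrier ℓ₂
  x ≤ y = ¬ (y < x)

  field
    _⊔_     : Carrier → Carrier → Carrier
    x≤x⊔y   : ∀ x y → x ≤ x ⊔ y
    y≤x⊔y   : ∀ x y → y ≤ x ⊔ y
    ⊔-least : ∀ {x y z} → x ≤ z → y ≤ z → x ⊔ y ≤ z

  ∣_∣ : Carrier → Carrier
  ∣ x ∣ = x ⊔ (- x)

  open RawMonoidDefs +-rawMonoid using () renaming (_×_ to _×′_)

  Cauchy : (ℕ → Carrier) → Set (c ⊔ˡ ℓ₂)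
  Cauchy s = ∀ ε → 0# < ε →
    ∃[ N ] (∀ m n → N ℕ.≤ m → N ℕ.≤ n → ∣ s m - s n ∣ < ε)

  ConvergesTo : (ℕ → Carrier) → Carrier → Set (c ⊔ˡ ℓ₂)
  ConvergesTo s x = ∀ ε → 0# < ε → ∃[ N ] (∀ n → N ℕ.≤ n → ∣ s n - x ∣ < ε)

  field
    archimedean : ∀ x → ∃[ n ] (x < n ×′ 1#)
    complete    : ∀ s → Cauchy s → ∃[ x ] ConvergesTo s x

module PairwiseComparison {c ℓ₁ ℓ₂} (ℝ : Reals c ℓ₁ ℓ₂) where

  open Reals ℝ
  open Summation semiring using (sum)
  open RingProperties ring using (-0#≈0#)

  private
    inverse : ∀ {x} → 0# < x → ∃[ y ] ((y * (x - 0#) ≈ 1#) × ((x - 0#) * y ≈ 1#))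
    inverse x>0 = #⇒invertible (#-sym (<⇒# x>0))

  infix 9 1/_

  1/_ : ∀ {x} → 0# < x → Carrier
  1/ x>0 = proj₁ (inverse x>0)

  1/-inverseʳ : ∀ {x} (x>0 : 0# < x) → x * 1/ x>0 ≈ 1#
  1/-inverseʳ {x} x>0 = trans (*-congʳ (sym x-0≈x)) (proj₂ (proj₂ (inverse x>0)))
    where
    x-0≈x : x - 0# ≈ x
    x-0≈x = trans (+-congˡ -0#≈0#) (+-identityʳ x)

  Vec : ℕ → Set c
  Vec n = Vector Carrier n

  Matrix : ℕ → Set c
  Matrix n = Vector (Vec n) n

  infixl 7 _·_ _·ᵥ_
  infix  8 _ᵀ

  _ᵀ : ∀ {n} → Matrix n → Matrix n
  A ᵀ = transpose A

  _·_ : ∀ {n} → Matrix n → Matrix n → Matrix n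
  (A · B) i k = sum (λ j → A i j * B j k)

  _·ᵥ_ : ∀ {n} → Matrix n → Vec n → Vec n
  (A ·ᵥ v) i = sum (λ j → A i j * v j)

  Positive : ∀ {n} → Vec n → Set ℓ₂
  Positive v = ∀ i → 0# < v i

  -- 𝒫𝒞 {n} is the set of n-by-n reciprocal matrices.
  record 𝒫𝒞 {n} (A : Matrix n) : Set (ℓ₁ ⊔ˡ ℓ₂) where
    field
      positive   : ∀ i j → 0# < A i j
      reciprocal : ∀ i j → A j i ≈ 1/ positive i j

  ColumnPerturbedConsistent : ∀ {n} → Matrix n → Set ℓ₁
  ColumnPerturbedConsistent {n} A =
    ∃[ k ] (∀ i j l → i ≢ k → j ≢ k → l ≢ k → A i l ≈ A i j * A j l)

  -- The matrix w w^(-T); up to `_≈_` it does not depend on the positivity proof.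
  ratios : ∀ {n} (w : Vec n) → Positive w → Matrix n
  ratios w w>0 i j = w i * 1/ w>0 j

  Proportional : ∀ {n} → Vec n → Vec n → Set (c ⊔ˡ ℓ₁)
  Proportional v w = ∃[ t ] (∀ i → v i ≈ t * w i)

  ℰ : ∀ {n} → Matrix n → Pred (Vec n) (c ⊔ˡ ℓ₁ ⊔ˡ ℓ₂)
  ℰ A w = Σ[ w>0 ∈ Positive w ] (∀ v (v>0 : Positive v) →
    (∀ i j → ∣ A i j - ratios v v>0 i j ∣ ≤ ∣ A i j - ratios w w>0 i j ∣) →
    Proportional v w)

  -- A real matrix may have non-real eigenvalues, and the spectral radius
  -- takes them into account.
  record ℂ : Set c where
    constructor _+i_
    field
      re im : Carrier

  open ℂ

  infix  4 _≈ᶜ_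
  infixl 7 _*ᶜ_ _·ᶜ_

  _≈ᶜ_ : Rel ℂ ℓ₁
  x ≈ᶜ y = (re x ≈ re y) × (im x ≈ im y)

  _*ᶜ_ : ℂ → ℂ → ℂ
  x *ᶜ y = (re x * re y - im x * im y) +i (re x * im y + im x * re y)

  IsModulus : ℂ → Carrier → Set (ℓ₁ ⊔ˡ ℓ₂)
  IsModulus x r = (0# ≤ r) × (r * r ≈ re x * re x + im x * im x)

  _·ᶜ_ : ∀ {n} → Matrix n → Vector ℂ n → Vector ℂ n
  (M ·ᶜ z) i = sum (λ j → M i j * re (z j)) +i sum (λ j → M i j * im (z j))

  NonZero : ∀ {n} → Vector ℂ n → Set ℓ₂
  NonZero z = ∃[ i ] (re (z i) # 0# ⊎ im (z i) # 0#)

  IsEigenvalue : ∀ {n} → Matrix n → ℂ → Set (c ⊔ˡ ℓ₁ ⊔ˡ ℓ₂)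
  IsEigenvalue M μ = ∃[ z ] (NonZero z × (∀ i → (M ·ᶜ z) i ≈ᶜ μ *ᶜ z i))

  record IsSpectralRadius {n} (M : Matrix n) (ρ : Carrier) : Set (c ⊔ˡ ℓ₁ ⊔ˡ ℓ₂) where
    field
      attained : ∃[ μ ] (IsEigenvalue M μ × IsModulus μ ρ)
      maximal  : ∀ μ r → IsEigenvalue M μ → IsModulus μ r → r ≤ ρ

  record IsPerronVector {n} (M : Matrix n) (w : Vec n) : Set (c ⊔ˡ ℓ₁ ⊔ˡ ℓ₂) where
    field
      positive         : Positive w
      ρ                : Carrier
      isSpectralRadius : IsSpectralRadius M ρ
      eigenvector      : ∀ i → (M ·ᵥ w) i ≈ ρ * w i

{-# OPTIONS --safe #-}

-- Write w = ρ⁻¹ A z with z entrywise positive: z = w for the Perron vector of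
-- A, and z = Aᵀ w for that of A Aᵀ.  Every such w is efficient.  Indeed, row j
-- of A dominates a_ji times row i as soon as no triad a_ji a_il a_lj exceeds 1,
-- and then w_j ≥ a_ji w_i; for any v at least as good as w this forces
-- v_j/w_j ≤ v_i/w_i.  If k is the perturbed index, only triads through k can
-- differ from 1, and for fixed m ≢ k they compare the numbers x_j = a_kj a_jm.
-- With x minimal at q and maximal at p, the rows dominate along
-- q → j → p → k → q for every j ≢ k, so all the quotients v_i/w_i coincide.

module Submission where

open import Defs
open import Algebra.Bundles using (CommutativeRing)
import Algebra.Apartness.Properties.HeytingCommutativeRing as HeytingProperties
import Algebra.Properties.Ring as RingProperties
import Algebra.Properties.Semiring.Sum as Summation
import Algebra.Solver.CommutativeMonoid as MonoidSolver
open import Data.Fin.Base using (Fin; zero; suc)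
open import Data.Fin.Properties using (_≟_)
open import Data.Nat.Base using (ℕ; zero; suc)
open import Data.Product.Base using (_×_; _,_; ∃-syntax; proj₁)
open import Data.Sum.Base using (_⊎_; inj₁; inj₂; [_,_]′)
open import Data.Vec.Functional using (Vector)
open import Function.Base using (id; flip; _∘_)
open import Relation.Binary.Bundles using (Poset)
open import Relation.Binary.Core using (Rel)
open import Relation.Binary.Definitions using (Transitive)
open import Relation.Binary.PropositionalEquality.Core as ≡ using (_≢_)
import Relation.Binary.Reasoning.PartialOrder as PosetReasoning
open import Relation.Binary.Structures using (IsStrictPartialOrder)
open import Relation.Nullary.Decidable.Core using (yes; no; ¬¬-excluded-middle)
open import Relation.Nullary.Negation.Core using (¬_; contradiction)
open import Relation.Unary using (Pred; _∈_)

-- Neither membership in `P` nor the comparison is decidable, so a maximum exists only up to double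
-- negation. The element `m` is the default bound when no value of `f` satisfies `P`.
¬¬-maximum : ∀ {b r p} {B : Set b} {_≲_ : Rel B r} →
  Transitive _≲_ → (∀ x y → ¬ ¬ (x ≲ y ⊎ y ≲ x)) →
  (P : Pred B p) → ∀ {n} (f : Vector B n) {m} → m ∈ P →
  ¬ ¬ (∃[ x ] (x ∈ P × (∀ i → f i ∈ P → f i ≲ x)))
¬¬-maximum ≲-trans total P {zero} f {m} Pm none = none (m , Pm , λ ())
¬¬-maximum {B = B} {_≲_} ≲-trans total P {suc n} f Pm none =
  ¬¬-maximum ≲-trans total P (f ∘ suc) Pm λ (x , Px , x-max) →
  ¬¬-excluded-middle (λ where
    (no ¬P₀) → none (x , Px , λ where
      zero P₀ → contradiction P₀ ¬P₀
      (suc i) → x-max i)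
    (yes P₀) → total (f zero) x (λ where
      (inj₁ f₀≲x) → none (x , Px , λ where
        zero _ → f₀≲x
        (suc i) → x-max i)
      -- Totality applied to equal arguments supplies reflexivity at `f zero`.
      (inj₂ x≲f₀) → total (f zero) (f zero) λ f₀≲f₀ → none (f zero , P₀ , λ where
        zero _ → [ id , id ]′ f₀≲f₀
        (suc i) Pi → ≲-trans (x-max i Pi) x≲f₀)))

module RealProperties {c ℓ₁ ℓ₂} (ℝ : Reals c ℓ₁ ℓ₂) where

  open Reals ℝ hiding (zero)
  open PairwiseComparison ℝ
  open Summation semiring using (sum; sum-cong-≋; ∑-comm; *-distribˡ-sum; *-distribʳ-sum)
  open RingProperties ring using (-‿distribˡ-*; -‿involutive; ⁻¹-anti-homo-//)
  open CommutativeRing commutativeRing using (*-commutativeMonoid)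
  open MonoidSolver *-commutativeMonoid using (solve; _⊜_; _⊕_)
  open HeytingProperties heytingCommutativeRing using (1#0; invertibleˡ⇒#; x-0≈x)
  open IsStrictPartialOrder <-isStrictPartialOrder
    using (irrefl; asym; <-respʳ-≈; <-respˡ-≈)
    renaming (trans to <-trans)

  -- Order arithmetic of the reals, finite sums and absolute values.

  <-cotrans : ∀ {x z} → x < z → ∀ y → x < y ⊎ y < z
  <-cotrans x<z y with #-cotrans (<⇒# x<z) y
  ... | inj₁ x#y = [ inj₁ , (λ y<x → inj₂ (<-trans y<x x<z)) ]′ (#⇒<⊎> x#y)
  ... | inj₂ y#z = [ inj₂ , (λ z<y → inj₁ (<-trans x<z z<y)) ]′ (#⇒<⊎> y#z)

  ≤-trans : Transitive _≤_
  ≤-trans {j = y} x≤y y≤z z<x = [ y≤z , x≤y ]′ (<-cotrans z<x y)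

  -- Apartness would give a strict inequality one way or the other; numbers that are not apart are
  -- equal by tightness.
  ≤-antisym : ∀ {x y} → x ≤ y → y ≤ x → x ≈ y
  ≤-antisym x≤y y≤x = proj₁ (tight _ _) ([ y≤x , x≤y ]′ ∘ #⇒<⊎>)

  <⇒≤ : ∀ {x y} → x < y → x ≤ y
  <⇒≤ = asym

  ≤-poset : Poset c ℓ₁ ℓ₂
  ≤-poset = record
    { _≤_ = _≤_
    ; isPartialOrder = record
      { isPreorder = record
        { isEquivalence = isEquivalence
        ; reflexive = λ x≈y → irrefl (sym x≈y)
        ; trans = ≤-trans
        }
      ; antisym = ≤-antisym
      }
    }

  open PosetReasoning ≤-poset

  ≤-¬¬-total : ∀ x y → ¬ ¬ (x ≤ y ⊎ y ≤ x)
  ≤-¬¬-total x y none = none (inj₁ λ y<x → none (inj₂ (<⇒≤ y<x)))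

  x+y-y≈x : ∀ x y → x + y - y ≈ x
  x+y-y≈x x y = trans (+-assoc x y (- y)) (trans (+-congˡ (-‿inverseʳ y)) (+-identityʳ x))

  +-cancelʳ-< : ∀ {x y} z → x + z < y + z → x < y
  +-cancelʳ-< z x+z<y+z = <-respʳ-≈ (x+y-y≈x _ z) (<-respˡ-≈ (x+y-y≈x _ z) (+-monoˡ-< (- z) x+z<y+z))

  +-monoˡ-≤ : ∀ {x y} z → x ≤ y → x + z ≤ y + z
  +-monoˡ-≤ z x≤y = x≤y ∘ +-cancelʳ-< z

  +-cancelʳ-≤ : ∀ {x y} z → x + z ≤ y + z → x ≤ y
  +-cancelʳ-≤ z x+z≤y+z = x+z≤y+z ∘ +-monoˡ-< z

  +-mono-≤ : ∀ {x y u v} → x ≤ y → u ≤ v → x + u ≤ y + v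
  +-mono-≤ {x} {y} {u} {v} x≤y u≤v = begin
    x + u ≤⟨ +-monoˡ-≤ u x≤y ⟩
    y + u ≈⟨ +-comm y u ⟩
    u + y ≤⟨ +-monoˡ-≤ y u≤v ⟩
    v + y ≈⟨ +-comm v y ⟩
    y + v ∎

  +-pos : ∀ {x y} → 0# < x → 0# < y → 0# < x + y
  +-pos {x} {y} x>0 y>0 = <-trans y>0 (<-respˡ-≈ (+-identityˡ y) (+-monoˡ-< y x>0))

  *-monoˡ-< : ∀ {x y z} → 0# < z → x < y → x * z < y * z
  *-monoˡ-< {x} {y} {z} z>0 x<y =
    +-cancelʳ-< (- (x * z)) (<-resp (sym (-‿inverseʳ (x * z))) [y-x]z≈yz-xz [y-x]z>0)
    where
    <-resp : ∀ {a a′ b b′} → a ≈ a′ → b ≈ b′ → a < b → a′ < b′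
    <-resp a≈a′ b≈b′ = <-respˡ-≈ a≈a′ ∘ <-respʳ-≈ b≈b′
    [y-x]z>0 : 0# < (y - x) * z
    [y-x]z>0 = *-pos (<-respˡ-≈ (-‿inverseʳ x) (+-monoˡ-< (- x) x<y)) z>0
    [y-x]z≈yz-xz : (y - x) * z ≈ y * z - x * z
    [y-x]z≈yz-xz = trans (distribʳ z y (- x)) (+-congˡ (sym (-‿distribˡ-* x z)))

  *-cancelʳ-≤ : ∀ {x y z} → 0# < z → x * z ≤ y * z → x ≤ y
  *-cancelʳ-≤ z>0 xz≤yz = xz≤yz ∘ *-monoˡ-< z>0

  0<1 : 0# < 1#
  0<1 with #⇒<⊎> 1#0
  ... | inj₂ 0<1 = 0<1
  ... | inj₁ 1<0 = <-respʳ-≈ -1*-1≈1 (*-pos 0<-1 0<-1)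
    where
    0<-1 : 0# < - 1#
    0<-1 = <-respʳ-≈ (+-identityˡ _) (<-respˡ-≈ (-‿inverseʳ 1#) (+-monoˡ-< (- 1#) 1<0))
    -1*-1≈1 : - 1# * - 1# ≈ 1#
    -1*-1≈1 = trans (sym (-‿distribˡ-* 1# (- 1#))) (trans (-‿cong (*-identityˡ (- 1#))) (-‿involutive 1#))

  1/-inverseˡ : ∀ {x} (x>0 : 0# < x) → 1/ x>0 * x ≈ 1#
  1/-inverseˡ x>0 = trans (*-comm _ _) (1/-inverseʳ x>0)

  -- The inverse is itself invertible, hence apart from zero; were it negative, multiplying by `x`
  -- would give 1 < 0.
  1/-pos : ∀ {x} (x>0 : 0# < x) → 0# < 1/ x>0
  1/-pos {x} x>0 with #⇒<⊎> (invertibleˡ⇒# (x , trans (*-congˡ (x-0≈x _)) (1/-inverseʳ x>0)))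
  ... | inj₂ 1/x>0 = 1/x>0
  ... | inj₁ 1/x<0 = contradiction 0<1
    (<⇒≤ (<-respˡ-≈ (1/-inverseˡ x>0) (<-respʳ-≈ (zeroˡ x) (*-monoˡ-< x>0 1/x<0))))

  -- Contraposing strict monotonicity yields only cancellation; cancelling the positive factor 1/z
  -- then gives monotonicity.
  *-monoˡ-≤ : ∀ {x y z} → 0# < z → x ≤ y → x * z ≤ y * z
  *-monoˡ-≤ {x} {y} {z} z>0 x≤y = *-cancelʳ-≤ (1/-pos z>0) (begin
    x * z * 1/ z>0   ≈⟨ cancel x ⟩
    x                ≤⟨ x≤y ⟩
    y                ≈⟨ cancel y ⟨
    y * z * 1/ z>0   ∎)
    where
    cancel : ∀ t → t * z * 1/ z>0 ≈ t
    cancel t = trans (*-assoc t z _) (trans (*-congˡ (1/-inverseʳ z>0)) (*-identityʳ t))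

  square≈1⇒≤1 : ∀ {x} → x * x ≈ 1# → x ≤ 1#
  square≈1⇒≤1 {x} xx≈1 1<x = irrefl (sym xx≈1)
    (<-trans 1<x (<-respˡ-≈ (*-identityˡ x) (*-monoˡ-< (<-trans 0<1 1<x) 1<x)))

  sum-mono-≤ : ∀ {n} {x y : Vec n} → (∀ i → x i ≤ y i) → sum x ≤ sum y
  sum-mono-≤ {zero}  x≤y = irrefl refl
  sum-mono-≤ {suc n} x≤y = +-mono-≤ (x≤y zero) (sum-mono-≤ (x≤y ∘ suc))

  -- The `Fin n` argument rules out the empty sum, which is zero.
  sum-pos : ∀ {n} {x : Vec n} → Fin n → Positive x → 0# < sum x
  sum-pos {suc zero}    _ x>0 = <-respʳ-≈ (sym (+-identityʳ _)) (x>0 zero)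
  sum-pos {suc (suc n)} _ x>0 = +-pos (x>0 zero) (sum-pos zero (x>0 ∘ suc))

  -- An approximation from above can only be improved downwards: p - a is at most the left side, and
  -- the right side is at most q - a because a ≤ q.
  ∣a-p∣≤∣a-q∣⇒p≤q : ∀ {a p q} → a ≤ q → ∣ a - p ∣ ≤ ∣ a - q ∣ → p ≤ q
  ∣a-p∣≤∣a-q∣⇒p≤q {a} {p} {q} a≤q ∣a-p∣≤∣a-q∣ = +-cancelʳ-≤ (- a) (begin
    p - a       ≈⟨ ⁻¹-anti-homo-// a p ⟨
    - (a - p)   ≤⟨ y≤x⊔y _ _ ⟩
    ∣ a - p ∣   ≤⟨ ∣a-p∣≤∣a-q∣ ⟩
    ∣ a - q ∣   ≤⟨ ⊔-least a-q≤q-a (irrefl (sym (⁻¹-anti-homo-// a q))) ⟩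
    q - a       ∎)
    where
    a-q≤q-a : a - q ≤ q - a
    a-q≤q-a = begin
      a - q   ≤⟨ +-monoˡ-≤ (- q) a≤q ⟩
      q - q   ≈⟨ -‿inverseʳ q ⟩
      0#      ≈⟨ -‿inverseʳ a ⟨
      a - a   ≤⟨ +-monoˡ-≤ (- a) a≤q ⟩
      q - a   ∎

  -- Matrix-vector products.

  ·ᵥ-pos : ∀ {n} {A : Matrix n} {v : Vec n} →
    (∀ i j → 0# < A i j) → Positive v → Positive (A ·ᵥ v)
  ·ᵥ-pos A>0 v>0 i = sum-pos i (λ j → *-pos (A>0 i j) (v>0 j))

  ·ᵥ-assoc : ∀ {n} (A B : Matrix n) (v : Vec n) i →
    ((A · B) ·ᵥ v) i ≈ (A ·ᵥ (B ·ᵥ v)) i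
  ·ᵥ-assoc A B v i = begin-equality
    sum (λ j → sum (λ l → A i l * B l j) * v j)
      ≈⟨ sum-cong-≋ (λ j → *-distribʳ-sum (v j) (λ l → A i l * B l j)) ⟩
    sum (λ j → sum (λ l → A i l * B l j * v j))
      ≈⟨ ∑-comm (λ j l → A i l * B l j * v j) ⟩
    sum (λ l → sum (λ j → A i l * B l j * v j))
      ≈⟨ sum-cong-≋ (λ l → sum-cong-≋ (λ j → *-assoc (A i l) (B l j) (v j))) ⟩
    sum (λ l → sum (λ j → A i l * (B l j * v j)))
      ≈⟨ sum-cong-≋ (λ l → *-distribˡ-sum (A i l) (λ j → B l j * v j)) ⟨
    sum (λ l → A i l * sum (λ j → B l j * v j))
      ∎

  -- Entrywise quotients of two positive vectors.

  quotient : ∀ {n} (v w : Vec n) → Positive w → Vec n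
  quotient v w w>0 i = v i * 1/ w>0 i

  -- Since w_j/w_i is at least a, being no farther from a forces v_j/v_i ≤ w_j/w_i; multiplying by
  -- v_i/w_j gives the claim.
  quotient-≤ : ∀ {n} {v w : Vec n} (v>0 : Positive v) (w>0 : Positive w) {a} i j →
    a * w i ≤ w j →
    ∣ a - ratios v v>0 j i ∣ ≤ ∣ a - ratios w w>0 j i ∣ →
    quotient v w w>0 j ≤ quotient v w w>0 i
  quotient-≤ {v = v} {w} v>0 w>0 {a} i j aw≤w closer = begin
    v j * 1/ w>0 j
      ≈⟨ *-identityʳ _ ⟨
    v j * 1/ w>0 j * 1#
      ≈⟨ *-congˡ (1/-inverseʳ (v>0 i)) ⟨
    v j * 1/ w>0 j * (v i * 1/ v>0 i)
      ≈⟨ solve 4 (λ vj wj vi vi⁻ → (vj ⊕ wj) ⊕ (vi ⊕ vi⁻) ⊜ (vj ⊕ vi⁻) ⊕ (vi ⊕ wj))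
           refl (v j) (1/ w>0 j) (v i) (1/ v>0 i) ⟩
    v j * 1/ v>0 i * (v i * 1/ w>0 j)
      ≤⟨ *-monoˡ-≤ (*-pos (v>0 i) (1/-pos (w>0 j))) (∣a-p∣≤∣a-q∣⇒p≤q a≤w/w closer) ⟩
    w j * 1/ w>0 i * (v i * 1/ w>0 j)
      ≈⟨ solve 4 (λ wj wi vi wj⁻ → (wj ⊕ wi) ⊕ (vi ⊕ wj⁻) ⊜ (vi ⊕ wi) ⊕ (wj ⊕ wj⁻))
           refl (w j) (1/ w>0 i) (v i) (1/ w>0 j) ⟩
    v i * 1/ w>0 i * (w j * 1/ w>0 j)
      ≈⟨ *-congˡ (1/-inverseʳ (w>0 j)) ⟩
    v i * 1/ w>0 i * 1#
      ≈⟨ *-identityʳ _ ⟩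
    v i * 1/ w>0 i ∎
    where
    a≤w/w : a ≤ w j * 1/ w>0 i
    a≤w/w = begin
      a                      ≈⟨ *-identityʳ a ⟨
      a * 1#                 ≈⟨ *-congˡ (1/-inverseʳ (w>0 i)) ⟨
      a * (w i * 1/ w>0 i)   ≈⟨ *-assoc a (w i) (1/ w>0 i) ⟨
      a * w i * 1/ w>0 i     ≤⟨ *-monoˡ-≤ (1/-pos (w>0 i)) aw≤w ⟩
      w j * 1/ w>0 i         ∎

  quotient-const⇒proportional : ∀ {n} {v w : Vec n} (w>0 : Positive w) k →
    (∀ i → quotient v w w>0 i ≈ quotient v w w>0 k) → Proportional v w
  quotient-const⇒proportional {v = v} {w} w>0 k const = quotient v w w>0 k , λ i → begin-equality
    v i                       ≈⟨ *-identityʳ (v i) ⟨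
    v i * 1#                  ≈⟨ *-congˡ (1/-inverseˡ (w>0 i)) ⟨
    v i * (1/ w>0 i * w i)    ≈⟨ *-assoc (v i) (1/ w>0 i) (w i) ⟨
    v i * 1/ w>0 i * w i      ≈⟨ *-congʳ (const i) ⟩
    v k * 1/ w>0 k * w i      ∎

  -- Row dominance.

  Dominates : ∀ {n} → Matrix n → Rel (Fin n) ℓ₂
  Dominates A j i = ∀ l → A j i * A i l ≤ A j l

  module _ {n} {A : Matrix n} {z w : Vec n} {ρ} (z>0 : Positive z) (ρ>0 : 0# < ρ)
    (Az≈ρw : ∀ i → (A ·ᵥ z) i ≈ ρ * w i) where

    -- Weighting the row inequality by the positive z_l and summing over l gives the claim
    -- multiplied by ρ.
    dominates⇒≤ : ∀ {i j} → Dominates A j i → A j i * w i ≤ w j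
    dominates⇒≤ {i} {j} j-dom-i = *-cancelʳ-≤ ρ>0 (begin
      A j i * w i * ρ                       ≈⟨ *-assoc (A j i) (w i) ρ ⟩
      A j i * (w i * ρ)                     ≈⟨ *-congˡ (*-comm (w i) ρ) ⟩
      A j i * (ρ * w i)                     ≈⟨ *-congˡ (Az≈ρw i) ⟨
      A j i * sum (λ l → A i l * z l)       ≈⟨ *-distribˡ-sum (A j i) (λ l → A i l * z l) ⟩
      sum (λ l → A j i * (A i l * z l))     ≈⟨ sum-cong-≋ (λ l → *-assoc (A j i) (A i l) (z l)) ⟨
      sum (λ l → A j i * A i l * z l)       ≤⟨ sum-mono-≤ (λ l → *-monoˡ-≤ (z>0 l) (j-dom-i l)) ⟩
      sum (λ l → A j l * z l)               ≈⟨ Az≈ρw j ⟩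
      ρ * w j                               ≈⟨ *-comm ρ (w j) ⟩
      w j * ρ                               ∎)

  -- Triads of a reciprocal matrix.

  module _ {n} {A : Matrix n} (A∈𝒫𝒞 : A ∈ 𝒫𝒞) where

    open 𝒫𝒞 A∈𝒫𝒞 renaming (positive to A>0)

    reciprocal-* : ∀ i j → A i j * A j i ≈ 1#
    reciprocal-* i j = trans (*-congˡ (reciprocal i j)) (1/-inverseʳ (A>0 i j))

    Triad≤1 : Fin n → Fin n → Fin n → Set ℓ₂
    Triad≤1 j i l = A j i * A i l * A l j ≤ 1#

    triad-rotate : ∀ {j i l} → Triad≤1 j i l → Triad≤1 i l j
    triad-rotate {j} {i} {l} t = begin
      A i l * A l j * A j i   ≈⟨ solve 3 (λ a b c → (a ⊕ b) ⊕ c ⊜ (c ⊕ a) ⊕ b) refl _ _ _ ⟩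
      A j i * A i l * A l j   ≤⟨ t ⟩
      1#                      ∎

    triads⇒dominates : ∀ {j i} → (∀ l → Triad≤1 j i l) → Dominates A j i
    triads⇒dominates {j} {i} t l = begin
      A j i * A i l                     ≈⟨ *-identityʳ _ ⟨
      A j i * A i l * 1#                ≈⟨ *-congˡ (reciprocal-* l j) ⟨
      A j i * A i l * (A l j * A j l)   ≈⟨ *-assoc _ _ _ ⟨
      A j i * A i l * A l j * A j l     ≤⟨ *-monoˡ-≤ (A>0 j l) (t l) ⟩
      1# * A j l                        ≈⟨ *-identityˡ _ ⟩
      A j l                             ∎

    -- Reciprocity at a diagonal position says that the square of the entry is 1, and the entry is
    -- positive.
    diagonal≤1 : ∀ i → A i i ≤ 1#
    diagonal≤1 i = square≈1⇒≤1 (reciprocal-* i i)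

    degenerate-triad≤1 : ∀ i k → Triad≤1 i k k
    degenerate-triad≤1 i k = begin
      A i k * A k k * A k i   ≈⟨ solve 3 (λ a b c → (a ⊕ b) ⊕ c ⊜ (a ⊕ c) ⊕ b) refl _ _ _ ⟩
      A i k * A k i * A k k   ≈⟨ *-congʳ (reciprocal-* i k) ⟩
      1# * A k k              ≈⟨ *-identityˡ _ ⟩
      A k k                   ≤⟨ diagonal≤1 k ⟩
      1#                      ∎

    -- Dominance in a matrix consistent away from the index `k`.

    module _ {k} (consistent : ∀ i j l → i ≢ k → j ≢ k → l ≢ k → A i l ≈ A i j * A j l) where

      consistent-triad : ∀ {j i l} → j ≢ k → i ≢ k → l ≢ k → Triad≤1 j i l
      consistent-triad {j} {i} {l} j≢k i≢k l≢k = begin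
        A j i * A i l * A l j   ≈⟨ *-congʳ (consistent j i l j≢k i≢k l≢k) ⟨
        A j l * A l j           ≈⟨ reciprocal-* j l ⟩
        1#                      ∎

      -- Factoring a_ji as a_jm a_mi away from `k` turns the triad into x_j / x_i, where x_i = a_ki
      -- a_im has inverse a_mi a_ik.
      perturbed-triad : ∀ {j i m} → j ≢ k → i ≢ k → m ≢ k →
        A k j * A j m ≤ A k i * A i m → Triad≤1 j i k
      perturbed-triad {j} {i} {m} j≢k i≢k m≢k xⱼ≤xᵢ = begin
        A j i * A i k * A k j
          ≈⟨ *-congʳ (*-congʳ (consistent j m i j≢k m≢k i≢k)) ⟩
        A j m * A m i * A i k * A k j
          ≈⟨ solve 4 (λ a b c d → ((a ⊕ b) ⊕ c) ⊕ d ⊜ (d ⊕ a) ⊕ (b ⊕ c)) refl _ _ _ _ ⟩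
        A k j * A j m * (A m i * A i k)
          ≤⟨ *-monoˡ-≤ (*-pos (A>0 m i) (A>0 i k)) xⱼ≤xᵢ ⟩
        A k i * A i m * (A m i * A i k)
          ≈⟨ solve 4 (λ a b c d → (a ⊕ b) ⊕ (c ⊕ d) ⊜ (a ⊕ d) ⊕ (b ⊕ c)) refl _ _ _ _ ⟩
        A k i * A i k * (A i m * A m i)
          ≈⟨ *-cong (reciprocal-* k i) (reciprocal-* i m) ⟩
        1# * 1#
          ≈⟨ *-identityˡ 1# ⟩
        1# ∎

      dominates-≢ : ∀ {j i} → j ≢ k → i ≢ k → Triad≤1 j i k → Dominates A j i
      dominates-≢ {j} {i} j≢k i≢k t = triads⇒dominates triad
        where
        triad : ∀ l → Triad≤1 j i l
        triad l with l ≟ k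
        ... | yes ≡.refl = t
        ... | no l≢k     = consistent-triad j≢k i≢k l≢k

      dominates-k : ∀ {p} → (∀ l → l ≢ k → Triad≤1 l p k) → Dominates A p k
      dominates-k {p} t = triads⇒dominates triad
        where
        triad : ∀ l → Triad≤1 p k l
        triad l with l ≟ k
        ... | yes ≡.refl = degenerate-triad≤1 p k
        ... | no l≢k     = triad-rotate (t l l≢k)

      k-dominates : ∀ {q} → (∀ l → l ≢ k → Triad≤1 q l k) → Dominates A k q
      k-dominates {q} t = triads⇒dominates triad
        where
        triad : ∀ l → Triad≤1 k q l
        triad l with l ≟ k
        ... | yes ≡.refl = triad-rotate (triad-rotate (degenerate-triad≤1 q k))
        ... | no l≢k     = triad-rotate (triad-rotate (t l l≢k))

      -- The extremal indices cannot be computed, since `_≤_` is undecidable;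
      -- their double negation suffices because `_≈_` is tight.
      dominance-monotone⇒constant : (r : Vec n) →
        (∀ {i j} → Dominates A j i → r j ≤ r i) → ∀ j → r j ≈ r k
      dominance-monotone⇒constant r mono j with j ≟ k
      ... | yes ≡.refl = refl
      ... | no j≢k     = ≤-antisym rⱼ≤rₖ rₖ≤rⱼ
        where
        x : Vec n
        -- The reference column is `j` itself, an index already known to differ from `k`.
        x i = A k i * A i j

        maximum : ¬ ¬ (∃[ p ] (p ≢ k × (∀ l → l ≢ k → x l ≤ x p)))
        maximum = ¬¬-maximum ≤-trans (λ i l → ≤-¬¬-total (x i) (x l)) (_≢ k) id j≢k

        minimum : ¬ ¬ (∃[ q ] (q ≢ k × (∀ l → l ≢ k → x q ≤ x l)))
        minimum = ¬¬-maximum (flip ≤-trans) (λ i l → ≤-¬¬-total (x l) (x i)) (_≢ k) id j≢k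

        rⱼ≤rₖ : r j ≤ r k
        -- Row j dominates row p, which dominates row k, so r_j ≤ r_p ≤ r_k.
        rⱼ≤rₖ rₖ<rⱼ = maximum λ (p , p≢k , p-max) →
          let triad : ∀ l → l ≢ k → Triad≤1 l p k
              triad l l≢k = perturbed-triad l≢k p≢k j≢k (p-max l l≢k)
          in ≤-trans (mono (dominates-≢ j≢k p≢k (triad j j≢k))) (mono (dominates-k triad)) rₖ<rⱼ

        rₖ≤rⱼ : r k ≤ r j
        -- Row k dominates row q, which dominates row j, so r_k ≤ r_q ≤ r_j.
        rₖ≤rⱼ rⱼ<rₖ = minimum λ (q , q≢k , q-min) →
          let triad : ∀ l → l ≢ k → Triad≤1 q l k
              triad l l≢k = perturbed-triad q≢k l≢k j≢k (q-min l l≢k)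
          in ≤-trans (mono (k-dominates triad)) (mono (dominates-≢ q≢k j≢k (triad j j≢k))) rⱼ<rₖ

    -- Keeping `z` separate from `w` lets one argument serve both Perron vectors.
    image-efficient : ColumnPerturbedConsistent A → ∀ {z w ρ} → Positive z → Positive w →
      (∀ i → (A ·ᵥ z) i ≈ ρ * w i) → w ∈ ℰ A
    image-efficient (k , consistent) {z} {w} {ρ} z>0 w>0 Az≈ρw = w>0 , λ v v>0 closer →
      quotient-const⇒proportional w>0 k
        (dominance-monotone⇒constant consistent (quotient v w w>0) λ {i} {j} j-dom-i →
          quotient-≤ v>0 w>0 i j (dominates⇒≤ z>0 ρ>0 Az≈ρw j-dom-i) (closer j i))
      where
      ρ>0 : 0# < ρ
      -- The scalar is a quotient of positive numbers, (A z)_k / w_k.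
      ρ>0 = <-respʳ-≈
        (trans (*-congʳ (Az≈ρw k))
          (trans (*-assoc ρ (w k) _) (trans (*-congˡ (1/-inverseʳ (w>0 k))) (*-identityʳ ρ))))
        (*-pos (·ᵥ-pos A>0 z>0 k) (1/-pos (w>0 k)))

corollary14 : ∀ {c ℓ₁ ℓ₂} (ℝ : Reals c ℓ₁ ℓ₂) → let open PairwiseComparison ℝ in
    (n : ℕ) (A : Matrix n) → A ∈ 𝒫𝒞 → ColumnPerturbedConsistent A →
    (∀ w → IsPerronVector (A · A ᵀ) w → w ∈ ℰ A) × (∀ w → IsPerronVector A w → w ∈ ℰ A)
corollary14 ℝ n A A∈𝒫𝒞 perturbed =
  (λ w perron → let open IsPerronVector perron in
    image-efficient A∈𝒫𝒞 perturbed (·ᵥ-pos (flip A>0) positive) positive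
      (λ i → trans (sym (·ᵥ-assoc A (A ᵀ) w i)) (eigenvector i))) ,
  (λ w perron → let open IsPerronVector perron in
    image-efficient A∈𝒫𝒞 perturbed positive positive eigenvector)
  where
  open PairwiseComparison ℝ
  open RealProperties ℝ
  open Reals ℝ using (trans; sym)
  open 𝒫𝒞 A∈𝒫𝒞 renaming (positive to A>0)
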